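{- Let $\Omega$ be a finite set and let $\Gamma\subseteq\Omega\times\Omega$ be a vertex-primitive digraph on $\Omega$ with $\Gamma\neq\emptyset$ and $\Gamma\neq\Omega\times\Omega$. Let $n=|\Omega|$ be the order of $\Gamma$ and let $d$ be its valency (every vertex has the same valency $d$). For each integer $i$, let $\Gamma_i$ be the graph on $\Omega$ consisting of all pairs $(\alpha,\beta)\in\Omega\times\Omega$ with $|\Gamma(\alpha)\cap\Gamma(\beta)|=d-i$. Let $\kappa$ be the smallest positive integer $i$ such that $\Gamma_i\neq\emptyset$. Then either (1) $\Gamma_0\cup\Gamma_\kappa=\Omega\times\Omega$ and $(n-1)(d-\kappa)=d(d-1)$; or (2) there exists $i\in\{\kappa,\ldots,d-1\}$ such that $\Gamma_i$ has valency at least $1$ and at most $\kappa^2+\kappa$.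
   Context: A digraph on a finite set $\Omega$ is a subset $\Gamma\subseteq\Omega\times\Omega$; for $v\in\Omega$, its neighbourhood is $\Gamma(v)=\{u\in\Omega:(v,u)\in\Gamma\}$ and its valency is $|\Gamma(v)|$. $\Gamma$ is regular of valency $d$ if every vertex has valency $d$. The automorphism group $\mathrm{Aut}(\Gamma)$ is the group of permutations of $\Omega$ preserving $\Gamma$; $\Gamma$ is vertex-primitive if $\mathrm{Aut}(\Gamma)$ acts primitively on $\Omega$ (preserves no nontrivial partition of $\Omega$). Each $\Gamma_i$ is invariant under $\mathrm{Aut}(\Gamma)$, and its valency means the common value of $|\Gamma_i(v)|$, $v\in\Omega$. -}

module Defs where

open import Data.Nat using (ℕ; zero; suc; _+_)
open import Data.Nat.Properties using (_≟_)
open import Data.Bool using (Bool; true; false; if_then_else_; _∧_)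
open import Data.Fin using (Fin; zero; suc)
open import Data.Product using (Σ; _×_; ∃; ∃-syntax)
open import Data.Sum using (_⊎_)
open import Function using (_∘_)
open import Function.Bundles using (Inverse; _↔_)
open import Relation.Binary.PropositionalEquality using (_≡_; _≢_)
open import Relation.Nullary.Decidable using (⌊_⌋)

Digraph : ℕ → Set
Digraph n = Fin n → Fin n → Bool

BRel : ℕ → Set
BRel n = Fin n → Fin n → Bool

count : ∀ {n} → (Fin n → Bool) → ℕ
count {zero}  f = 0
count {suc n} f = (if f zero then 1 else 0) + count (f ∘ suc)

Perm : ℕ → Set
Perm n = Fin n ↔ Fin n

IsAut : ∀ {n} → Digraph n → Perm n → Set
IsAut Γ σ = ∀ x y → Γ (Inverse.to σ x) (Inverse.to σ y) ≡ Γ x y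

IsEquivRel : ∀ {n} → BRel n → Set
IsEquivRel R = (∀ x → R x x ≡ true)
             × (∀ x y → R x y ≡ true → R y x ≡ true)
             × (∀ x y z → R x y ≡ true → R y z ≡ true → R x z ≡ true)

Preserves : ∀ {n} → Perm n → BRel n → Set
Preserves σ R = ∀ x y → R x y ≡ true → R (Inverse.to σ x) (Inverse.to σ y) ≡ true

VertexPrimitive : ∀ {n} → Digraph n → Set
VertexPrimitive {n} Γ =
  (∀ x y → ∃[ σ ] (IsAut Γ σ × Inverse.to σ x ≡ y))
  × (∀ (R : BRel n) → IsEquivRel R → (∀ σ → IsAut Γ σ → Preserves σ R) →
       (∀ x y → R x y ≡ true → x ≡ y) ⊎ (∀ x y → R x y ≡ true))

nbhd : ∀ {n} → Digraph n → Fin n → Fin n → Bool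
nbhd Γ v u = Γ v u

valency : ∀ {n} → Digraph n → Fin n → ℕ
valency Γ v = count (nbhd Γ v)

common : ∀ {n} → Digraph n → Fin n → Fin n → ℕ
common Γ α β = count (λ γ → nbhd Γ α γ ∧ nbhd Γ β γ)

-- Γ_i = {(α,β) : |Γ(α) ∩ Γ(β)| = d - i}, for natural i
-- (for negative i, Γ_i is empty since |Γ(α) ∩ Γ(β)| ≤ d; for i ≤ d the
-- condition |Γ(α) ∩ Γ(β)| = d - i is equivalent to |Γ(α)∩Γ(β)| + i = d,
-- and for i > d both sides define the empty graph).
GammaI : ∀ {n} → Digraph n → (d i : ℕ) → Digraph n
GammaI Γ d i α β = ⌊ common Γ α β + i ≟ d ⌋

NonEmpty : ∀ {n} → Digraph n → Set
NonEmpty Γ = ∃[ α ] ∃[ β ] (Γ α β ≡ true)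

IsFull : ∀ {n} → Digraph n → Set
IsFull Γ = ∀ α β → Γ α β ≡ true

{-# OPTIONS --safe #-}
-- By transitivity and double counting, the in-neighbourhood of a vertex, a set of size d, has an
-- edge cut of size exactly κm in the symmetric graph Γ_κ, where m is the valency of Γ_κ. Suppose
-- that m > κ² + κ and κ < d < n − κ. Among the sets S with κ < |S| < n − κ take one of minimal cut,
-- and then of minimal size s. Its cut is at most κm, so s(m + 1 − s) ≤ κm, which forces s > 2κ.
-- Since the cut function is submodular and posimodular, two translates A, B of S are equal or
-- disjoint: uncross through A ∩ B, A ∪ B if |A ∩ B| > κ, and through A ∖ B, B ∖ A otherwise.
-- So the translates form a system of imprimitivity, which is impossible.
-- Hence m ≤ κ² + κ, or d ≤ κ, or d ≥ n − κ. In the last two cases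
-- |Γ(α) ∖ Γ(β)| ≤ min (d, n − d) ≤ κ for all α, β, so that only Γ₀ and Γ_κ occur; as Γ₀ is equality
-- by primitivity, the count Σ_β |Γ(α) ∩ Γ(β)| = d² gives the equation.
module Submission where

open import Defs
open import Data.Nat using (ℕ; zero; suc; _+_; _*_; _∸_; _^_; _≤_; _<_; z≤n; s≤s; _≤?_)
open import Data.Nat.Properties hiding (suc-injective; 0≢1+n)
open import Data.Nat.Induction using (<-wellFounded)
open import Data.Nat.Tactic.RingSolver using (solve-∀)
open import Algebra.Properties.Semiring.Sum +-*-semiring
  using (sum; sum-cong-≗; sum-remove; sum-permute; ∑-distrib-+; ∑-comm; *-distribˡ-sum; *-distribʳ-sum)
open import Data.Bool using (Bool; true; false; _∧_; _∨_; not; if_then_else_)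
open import Data.Bool.Properties using (∧-comm; ∧-idem; ∧-zeroʳ; ∧-identityʳ; ¬-not)
open import Data.Fin using (Fin; zero; suc; punchIn)
open import Data.Fin.Properties using (punchInᵢ≢i; suc-injective; 0≢1+n)
open import Data.Product using (_×_; _,_; proj₁; proj₂; ∃-syntax)
open import Data.Sum using (_⊎_; inj₁; inj₂; [_,_]′)
open import Data.Empty using (⊥; ⊥-elim)
open import Function using (_∘_; case_of_)
open import Function.Bundles using (Inverse)
open import Induction.WellFounded using (Acc; acc)
open import Relation.Nullary using (¬_; Dec; yes; no; contradiction)
open import Relation.Nullary.Decidable using (⌊_⌋; from-yes; map′; _×-dec_)
open import Relation.Binary.PropositionalEquality
  using (_≡_; _≢_; refl; sym; trans; cong; cong₂; subst; subst₂; module ≡-Reasoning)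

-- Finite sums

private variable n : ℕ

sum-mono : {f g : Fin n → ℕ} → (∀ x → f x ≤ g x) → sum f ≤ sum g
sum-mono {zero}  f≤g = z≤n
sum-mono {suc n} f≤g = +-mono-≤ (f≤g zero) (sum-mono (f≤g ∘ suc))

sum-const : ∀ n {k} → sum {n} (λ _ → k) ≡ n * k
sum-const zero        = refl
sum-const (suc n) {k} = cong (k +_) (sum-const n)

-- Transitivity makes a quantity constant and a double count gives its total; together they give its
-- value. The point `x` guarantees `n > 0`, so that `n` cancels.
constant-from-sum : {f : Fin n → ℕ} {k : ℕ} → (∀ x y → f x ≡ f y) → sum f ≡ n * k → ∀ x → f x ≡ k
constant-from-sum {suc n} {f} {k} const Σf≡ x =
  *-cancelˡ-≡ (f x) k (suc n) (trans (sym (sum-const (suc n))) (trans (sum-cong-≗ (const x)) Σf≡))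

∑∑ : (Fin n → Fin n → ℕ) → ℕ
∑∑ f = sum λ x → sum (f x)

∑∑-cong : {f g : Fin n → Fin n → ℕ} → (∀ x y → f x y ≡ g x y) → ∑∑ f ≡ ∑∑ g
∑∑-cong f≡g = sum-cong-≗ λ x → sum-cong-≗ (f≡g x)

∑∑-mono : {f g : Fin n → Fin n → ℕ} → (∀ x y → f x y ≤ g x y) → ∑∑ f ≤ ∑∑ g
∑∑-mono f≤g = sum-mono λ x → sum-mono (f≤g x)

∑∑-distrib-+ : (f g : Fin n → Fin n → ℕ) → ∑∑ (λ x y → f x y + g x y) ≡ ∑∑ f + ∑∑ g
∑∑-distrib-+ f g = trans (sum-cong-≗ λ x → ∑-distrib-+ (f x) (g x)) (∑-distrib-+ (sum ∘ f) (sum ∘ g))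

-- Counting

⟦_⟧ : Bool → ℕ
⟦ b ⟧ = if b then 1 else 0

-- Makes Boolean identities and inequalities provable by evaluating every case, through `from-yes`.
∀Bool? : {P : Bool → Set} → (∀ b → Dec (P b)) → Dec (∀ b → P b)
∀Bool? P? = map′ (λ { (t , f) true → t ; (t , f) false → f }) (λ p → p true , p false)
                 (P? true ×-dec P? false)

⟦∧⟧+⟦∧not⟧ : ∀ a b → ⟦ a ∧ b ⟧ + ⟦ a ∧ not b ⟧ ≡ ⟦ a ⟧
⟦∧⟧+⟦∧not⟧ = from-yes (∀Bool? λ a → ∀Bool? λ b → ⟦ a ∧ b ⟧ + ⟦ a ∧ not b ⟧ ≟ ⟦ a ⟧)

⟦∧⟧+⟦∨⟧ : ∀ a b → ⟦ a ∧ b ⟧ + ⟦ a ∨ b ⟧ ≡ ⟦ a ⟧ + ⟦ b ⟧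
⟦∧⟧+⟦∨⟧ = from-yes (∀Bool? λ a → ∀Bool? λ b → ⟦ a ∧ b ⟧ + ⟦ a ∨ b ⟧ ≟ ⟦ a ⟧ + ⟦ b ⟧)

⟦∧⟧ : ∀ a b → ⟦ a ∧ b ⟧ ≡ ⟦ a ⟧ * ⟦ b ⟧
⟦∧⟧ = from-yes (∀Bool? λ a → ∀Bool? λ b → ⟦ a ∧ b ⟧ ≟ ⟦ a ⟧ * ⟦ b ⟧)

count≡sum : (p : Fin n → Bool) → count p ≡ sum (⟦_⟧ ∘ p)
count≡sum {zero}  p = refl
count≡sum {suc n} p = cong (⟦ p zero ⟧ +_) (count≡sum (p ∘ suc))

count-cong : {p q : Fin n → Bool} → (∀ x → p x ≡ q x) → count p ≡ count q
count-cong {p = p} {q} p≡q = trans (count≡sum p) (trans (sum-cong-≗ (cong ⟦_⟧ ∘ p≡q)) (sym (count≡sum q)))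

count-mono : {p q : Fin n → Bool} → (∀ x → p x ≡ true → q x ≡ true) → count p ≤ count q
count-mono {p = p} {q} p⊆q =
  subst₂ _≤_ (sym (count≡sum p)) (sym (count≡sum q)) (sum-mono λ x → ⟦⟧-mono (p x) (q x) (p⊆q x))
  where
  ⟦⟧-mono : ∀ a b → (a ≡ true → b ≡ true) → ⟦ a ⟧ ≤ ⟦ b ⟧
  ⟦⟧-mono false b a⇒b = z≤n
  ⟦⟧-mono true  b a⇒b = ≤-reflexive (cong ⟦_⟧ (sym (a⇒b refl)))

count-strict : {p q : Fin n → Bool} → (∀ x → p x ≡ true → q x ≡ true) →
               ∀ z → p z ≡ false → q z ≡ true → count p < count q
count-strict {p = p} p⊆q zero pz qz rewrite pz | qz = s≤s (count-mono (p⊆q ∘ suc))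
count-strict {p = p} {q} p⊆q (suc z) pz qz with p zero in p₀ | q zero in q₀
... | false | false = count-strict (p⊆q ∘ suc) z pz qz
... | false | true  = m<n⇒m<1+n (count-strict (p⊆q ∘ suc) z pz qz)
... | true  | true  = s≤s (count-strict (p⊆q ∘ suc) z pz qz)
... | true  | false = case trans (sym q₀) (p⊆q zero p₀) of λ ()

⊆-count-≥ : {p q : Fin n → Bool} → (∀ x → p x ≡ true → q x ≡ true) →
            count q ≤ count p → ∀ x → q x ≡ true → p x ≡ true
⊆-count-≥ {p = p} p⊆q |q|≤|p| x qx with p x in px
... | true  = refl
... | false = ⊥-elim (<⇒≱ (count-strict p⊆q x px qx) |q|≤|p|)

count-∃ : {p : Fin n → Bool} → 0 < count p → ∃[ x ] p x ≡ true
count-∃ {suc n} {p} 0<|p| with p zero in p₀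
... | true  = zero , p₀
... | false = let x , px = count-∃ 0<|p| in suc x , px

count-∈ : {p : Fin n → Bool} (x : Fin n) → p x ≡ true → 0 < count p
count-∈ {p = p} zero    px rewrite px = s≤s z≤n
count-∈ {p = p} (suc x) px = ≤-trans (count-∈ x px) (m≤n+m _ ⟦ p zero ⟧)

count-≤1 : {p : Fin n → Bool} → (∀ x y → p x ≡ true → p y ≡ true → x ≡ y) → count p ≤ 1
count-≤1 {zero}      unique = z≤n
count-≤1 {suc n} {p} unique with p zero in p₀
... | false = count-≤1 λ x y px py → suc-injective (unique (suc x) (suc y) px py)
... | true  = s≤s (≮⇒≥ λ 0<rest → let x , px = count-∃ 0<rest in 0≢1+n (unique zero (suc x) p₀ px))

count-full : {p : Fin n → Bool} → (∀ x → p x ≡ true) → count p ≡ n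
count-full {zero}  p≡true = refl
count-full {suc n} p≡true rewrite p≡true zero = cong suc (count-full (p≡true ∘ suc))

count-≤ : (p : Fin n → Bool) → count p ≤ n
count-≤ p = ≤-trans (count-mono {p = p} {q = λ _ → true} λ _ _ → refl) (≤-reflexive (count-full λ _ → refl))

count-∧-not : (p q : Fin n → Bool) → count (λ x → p x ∧ q x) + count (λ x → p x ∧ not (q x)) ≡ count p
count-∧-not p q
  rewrite count≡sum (λ x → p x ∧ q x) | count≡sum (λ x → p x ∧ not (q x)) | count≡sum p
  = trans (sym (∑-distrib-+ (λ x → ⟦ p x ∧ q x ⟧) _)) (sum-cong-≗ λ x → ⟦∧⟧+⟦∧not⟧ (p x) (q x))

count-∧-∨ : (p q : Fin n → Bool) → count (λ x → p x ∧ q x) + count (λ x → p x ∨ q x) ≡ count p + count q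
count-∧-∨ p q
  rewrite count≡sum (λ x → p x ∧ q x) | count≡sum (λ x → p x ∨ q x) | count≡sum p | count≡sum q
  = trans (sym (∑-distrib-+ (λ x → ⟦ p x ∧ q x ⟧) _))
   (trans (sum-cong-≗ λ x → ⟦∧⟧+⟦∨⟧ (p x) (q x)) (∑-distrib-+ (⟦_⟧ ∘ p) (⟦_⟧ ∘ q)))

count-not : (p : Fin n → Bool) → count p + count (not ∘ p) ≡ n
count-not p = trans (count-∧-not (λ _ → true) p) (count-full λ _ → refl)

count-perm : (σ : Perm n) (p : Fin n → Bool) → count (p ∘ Inverse.to σ) ≡ count p
count-perm σ p = trans (count≡sum (p ∘ Inverse.to σ)) (trans (sym (sum-permute (⟦_⟧ ∘ p) σ)) (sym (count≡sum p)))

∧-true : ∀ {a b} → a ∧ b ≡ true → a ≡ true × b ≡ true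
∧-true {true} {true} _ = refl , refl

-- Edge cuts

cut : BRel n → (Fin n → Bool) → ℕ
cut E S = ∑∑ λ x y → ⟦ S x ∧ not (S y) ∧ E x y ⟧

-- The inequality holds arc by arc, for all 32 combinations of the four memberships and of `E x y`.
cut-submodular : (E : BRel n) (S T : Fin n → Bool) →
  cut E (λ x → S x ∧ T x) + cut E (λ x → S x ∨ T x) ≤ cut E S + cut E T
cut-submodular E S T = subst₂ _≤_
  (∑∑-distrib-+ (λ x y → ⟦ (S x ∧ T x) ∧ not (S y ∧ T y) ∧ E x y ⟧) _)
  (∑∑-distrib-+ (λ x y → ⟦ S x ∧ not (S y) ∧ E x y ⟧) _)
  (∑∑-mono λ x y → pointwise (S x) (T x) (S y) (T y) (E x y))
  where
  pointwise : ∀ a c b d e →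
    ⟦ (a ∧ c) ∧ not (b ∧ d) ∧ e ⟧ + ⟦ (a ∨ c) ∧ not (b ∨ d) ∧ e ⟧ ≤
    ⟦ a ∧ not b ∧ e ⟧ + ⟦ c ∧ not d ∧ e ⟧
  pointwise = from-yes (∀Bool? λ a → ∀Bool? λ c → ∀Bool? λ b → ∀Bool? λ d → ∀Bool? λ e →
    ⟦ (a ∧ c) ∧ not (b ∧ d) ∧ e ⟧ + ⟦ (a ∨ c) ∧ not (b ∨ d) ∧ e ⟧ ≤?
    ⟦ a ∧ not b ∧ e ⟧ + ⟦ c ∧ not d ∧ e ⟧)

cut-cong : (E : BRel n) {S T : Fin n → Bool} → (∀ x → S x ≡ T x) → cut E S ≡ cut E T
cut-cong E S≡T = ∑∑-cong λ x y → cong₂ (λ a b → ⟦ a ∧ not b ∧ E x y ⟧) (S≡T x) (S≡T y)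

module _ {E : BRel n} (E-sym : ∀ x y → E x y ≡ E y x) where

  cut-not : (S : Fin n → Bool) → cut E (not ∘ S) ≡ cut E S
  cut-not S = trans (∑-comm λ x y → ⟦ not (S x) ∧ not (not (S y)) ∧ E x y ⟧)
                    (∑∑-cong λ y x → cong ⟦_⟧ (swap (S x) (S y) (E-sym x y)))
    where
    swap : ∀ a b {e e′} → e ≡ e′ → not a ∧ not (not b) ∧ e ≡ b ∧ not a ∧ e′
    swap true  true  refl = refl
    swap true  false refl = refl
    swap false true  refl = refl
    swap false false refl = refl

  -- Submodularity for `S` and the complement of `T`: their union is the complement of `T ∖ S`, and
  -- for symmetric `E` a set and its complement have the same cut.
  cut-posimodular : (S T : Fin n → Bool) →
    cut E (λ x → S x ∧ not (T x)) + cut E (λ x → T x ∧ not (S x)) ≤ cut E S + cut E T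
  cut-posimodular S T = subst₂ _≤_
    (cong (cut E (λ x → S x ∧ not (T x)) +_)
      (trans (cut-cong E λ x → deMorgan (S x) (T x)) (cut-not (λ x → T x ∧ not (S x)))))
    (cong (cut E S +_) (cut-not T))
    (cut-submodular E S (not ∘ T))
    where
    deMorgan : ∀ a b → a ∨ not b ≡ not (b ∧ not a)
    deMorgan true  true  = refl
    deMorgan true  false = refl
    deMorgan false true  = refl
    deMorgan false false = refl

cut-perm : {E : BRel n} (σ : Perm n) → (∀ x y → E (Inverse.to σ x) (Inverse.to σ y) ≡ E x y) →
           (S : Fin n → Bool) → cut E (S ∘ Inverse.to σ) ≡ cut E S
cut-perm {E = E} σ E-inv S =
  trans (∑∑-cong λ x y → cong (λ e → ⟦ S (to x) ∧ not (S (to y)) ∧ e ⟧) (sym (E-inv x y)))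
 (trans (sum-cong-≗ λ x → sym (sum-permute (λ y → ⟦ S (to x) ∧ not (S y) ∧ E (to x) y ⟧) σ))
        (sym (sum-permute (λ x → sum λ y → ⟦ S x ∧ not (S y) ∧ E x y ⟧) σ)))
  where to = Inverse.to σ

-- This is `s(m + 1 - s) ≤ cut E S` without subtraction: a point of `S` has at most `s - 1`
-- neighbours in `S`, so at least `m + 1 - s` outside.
cut-lower-bound : {E : BRel n} {m : ℕ} → (∀ x → E x x ≡ false) → (∀ x → count (E x) ≡ m) →
  (S : Fin n → Bool) → count S * m + count S ≤ cut E S + count S * count S
cut-lower-bound {n} {E} {m} E-irr E-reg S = begin
  s * m + s
    ≡⟨ cong (λ t → t * m + t) (count≡sum S) ⟩
  sum (⟦_⟧ ∘ S) * m + sum (⟦_⟧ ∘ S)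
    ≡⟨ cong (_+ _) (*-distribʳ-sum m (⟦_⟧ ∘ S)) ⟩
  sum (λ x → ⟦ S x ⟧ * m) + sum (⟦_⟧ ∘ S)
    ≡⟨ ∑-distrib-+ (λ x → ⟦ S x ⟧ * m) (⟦_⟧ ∘ S) ⟨
  sum (λ x → ⟦ S x ⟧ * m + ⟦ S x ⟧)
    ≤⟨ sum-mono row ⟩
  sum (λ x → sum (λ y → ⟦ S x ∧ not (S y) ∧ E x y ⟧) + ⟦ S x ⟧ * s)
    ≡⟨ ∑-distrib-+ (λ x → sum (λ y → ⟦ S x ∧ not (S y) ∧ E x y ⟧)) (λ x → ⟦ S x ⟧ * s) ⟩
  cut E S + sum (λ x → ⟦ S x ⟧ * s)
    ≡⟨ cong (cut E S +_) (*-distribʳ-sum s (⟦_⟧ ∘ S)) ⟨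
  cut E S + sum (⟦_⟧ ∘ S) * s
    ≡⟨ cong (λ t → cut E S + t * s) (count≡sum S) ⟨
  cut E S + s * s ∎
  where
  open ≤-Reasoning
  s = count S
  row : ∀ x → ⟦ S x ⟧ * m + ⟦ S x ⟧ ≤ sum (λ y → ⟦ S x ∧ not (S y) ∧ E x y ⟧) + ⟦ S x ⟧ * s
  row x with S x in Sx
  ... | false = z≤n
  ... | true  = begin
    1 * m + 1
      ≡⟨ cong (_+ 1) (trans (*-identityˡ m) (sym (E-reg x))) ⟩
    count (E x) + 1
      ≡⟨ cong (_+ 1) (count-∧-not (E x) S) ⟨
    inner + outer + 1
      ≡⟨ trans (cong (_+ 1) (+-comm inner outer)) (trans (+-assoc outer inner 1) (cong (outer +_) (+-comm inner 1))) ⟩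
    outer + suc inner
      -- Strict because `x` lies in `S` but is not its own neighbour.
      ≤⟨ +-monoʳ-≤ outer (count-strict (λ y → proj₂ ∘ ∧-true {E x y}) x (cong (_∧ S x) (E-irr x)) Sx) ⟩
    outer + s
      ≡⟨ cong₂ _+_ (trans (count-cong λ y → ∧-comm (E x y) (not (S y))) (count≡sum (λ y → not (S y) ∧ E x y))) (sym (*-identityˡ s)) ⟩
    sum (λ y → ⟦ not (S y) ∧ E x y ⟧) + 1 * s ∎
    where
    inner = count λ y → E x y ∧ S y
    outer = count λ y → E x y ∧ not (S y)

-- The concave function `s(m + 1 - s)` takes the value `(κ + 1)(m - κ) > κm` at both `s = κ + 1` and
-- `s = m - κ`, so `bound` fails between them. Hence `s > m - κ > κ²`, so `s ≥ κ² + 2 > 2κ`.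
large-if-small-cut : ∀ {s m κ} → s * m + s ≤ κ * m + s * s → κ < s → κ * κ + κ < m → κ + κ < s
large-if-small-cut {s} {m} {κ} bound κ<s κ²+κ<m with s + κ ≤? m
... | yes s+κ≤m with m≤n⇒∃[o]m+o≡n κ<s | m≤n⇒∃[o]m+o≡n s+κ≤m
...   | a , refl | b , refl = ⊥-elim (<⇒≱ exceeds (+-monoˡ-≤ (κ * κ) bound))
  where
  open ≤-Reasoning
  -- Here `a = s - κ - 1` and `b = m - s - κ`, whence `κ + a + b = m - κ - 1`, which is at least
  -- `κ²`. Adding `κ * κ` to both sides avoids subtraction.
  identity : ∀ a b κ →
    (suc κ + a) * (suc κ + a + κ + b) + (suc κ + a) + κ * κ ≡
    suc (κ * (suc κ + a + κ + b) + (suc κ + a) * (suc κ + a) + (κ + a + b) + a * b)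
  identity = solve-∀
  κ²≤ : κ * κ ≤ κ + a + b
  κ²≤ = +-cancelʳ-≤ (suc κ) _ _ (begin
    κ * κ + suc κ         ≡⟨ +-suc (κ * κ) κ ⟩
    suc (κ * κ + κ)       ≤⟨ κ²+κ<m ⟩
    suc κ + a + κ + b     ≡⟨ rearrange κ a b ⟩
    κ + a + b + suc κ     ∎)
    where
    rearrange : ∀ κ a b → suc κ + a + κ + b ≡ κ + a + b + suc κ
    rearrange = solve-∀
  exceeds : κ * (suc κ + a + κ + b) + (suc κ + a) * (suc κ + a) + κ * κ <
            (suc κ + a) * (suc κ + a + κ + b) + (suc κ + a) + κ * κ
  exceeds = begin-strict
    c + κ * κ                      ≤⟨ +-monoʳ-≤ c κ²≤ ⟩
    c + (κ + a + b)                ≤⟨ m≤m+n _ (a * b) ⟩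
    c + (κ + a + b) + a * b        <⟨ n<1+n _ ⟩
    suc (c + (κ + a + b) + a * b)  ≡⟨ identity a b κ ⟨
    (suc κ + a) * (suc κ + a + κ + b) + (suc κ + a) + κ * κ ∎
    where c = κ * (suc κ + a + κ + b) + (suc κ + a) * (suc κ + a)
large-if-small-cut {s} {m} {κ} bound κ<s κ²+κ<m | no s+κ≰m =
  ≤-<-trans (2κ≤κ²+1 κ) (+-cancelʳ-≤ κ _ _ (≤-trans (s≤s κ²+κ<m) (≰⇒> s+κ≰m)))
  where
  identity : ∀ k → suc (suc k * suc k) ≡ (suc k + suc k) + k * k
  identity = solve-∀
  2κ≤κ²+1 : ∀ κ → κ + κ ≤ suc (κ * κ)
  2κ≤κ²+1 zero    = z≤n
  2κ≤κ²+1 (suc k) = ≤-trans (m≤m+n _ (k * k)) (≤-reflexive (sym (identity k)))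

-- Vertex-primitivity

private to = Inverse.to

module _ {Γ : Digraph n} (prim : VertexPrimitive Γ) where

  invariant⇒constant : {f : Fin n → ℕ} → (∀ σ → IsAut Γ σ → ∀ x → f (to σ x) ≡ f x) →
                       ∀ x y → f x ≡ f y
  invariant⇒constant {f} f-inv x y with proj₁ prim x y
  ... | σ , σ-aut , σx≡y = trans (sym (f-inv σ σ-aut x)) (cong f σx≡y)

  -- Atoms and uncrossing

  module _ {E : BRel n} (E-sym : ∀ x y → E x y ≡ E y x)
           (E-inv : ∀ σ → IsAut Γ σ → ∀ x y → E (to σ x) (to σ y) ≡ E x y)
           {κ : ℕ} where

    -- The second condition says that the complement also has more than `κ` points, so the class is
    -- closed under complement.
    Balanced : (Fin n → Bool) → Set
    Balanced S = κ < count S × count S + κ < n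

    -- `S` is an atom in the sense of connectivity theory: a smallest set among the balanced sets of
    -- least cut.
    module Atom (S : Fin n → Bool) (S-balanced : Balanced S) (2κ<|S| : κ + κ < count S)
                (cut-min : ∀ T → Balanced T → cut E S ≤ cut E T)
                (size-min : ∀ T → Balanced T → cut E T ≤ cut E S → count S ≤ count T) where

      private s = count S

      -- Uncrossing needs only these two numbers of a translate, so no record is kept of the
      -- automorphism that produced it.
      Copy : (Fin n → Bool) → Set
      Copy T = cut E T ≡ cut E S × count T ≡ s

      copy-∘ : {T : Fin n → Bool} (σ : Perm n) → IsAut Γ σ → Copy T → Copy (T ∘ to σ)
      copy-∘ {T} σ σ-aut (cutT , |T|) =
        trans (cut-perm σ (E-inv σ σ-aut) T) cutT , trans (count-perm σ T) |T|

      -- The complement of `S` is balanced with the same cut, hence no smaller than `S`.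
      2|S|≤n : s + s ≤ n
      2|S|≤n = ≤-trans (+-monoʳ-≤ s (size-min (not ∘ S) (κ<|S̅| , |S̅|+κ<n) (≤-reflexive (cut-not E-sym S))))
                       (≤-reflexive (count-not S))
        where
        |S̅| = count (not ∘ S)
        κ<|S̅| : κ < |S̅|
        κ<|S̅| = +-cancelˡ-< s κ |S̅| (subst (s + κ <_) (sym (count-not S)) (proj₂ S-balanced))
        |S̅|+κ<n : |S̅| + κ < n
        |S̅|+κ<n = subst (|S̅| + κ <_) (trans (+-comm |S̅| s) (count-not S)) (+-monoʳ-< |S̅| (proj₁ S-balanced))

      balanced-smaller : {T : Fin n → Bool} → κ < count T → count T ≤ s → Balanced T
      balanced-smaller κ<|T| |T|≤s = κ<|T| , ≤-<-trans (+-monoˡ-≤ κ |T|≤s) (proj₂ S-balanced)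

      -- Of the two sets produced by uncrossing, one has cut at least `cut E S`, so the other has
      -- cut at most `cut E S`, and `size-min` forbids it to be smaller than `A`. So `A ∩ B` is all
      -- of `A`, while the case of `A ∖ B`, which misses `z`, is impossible.
      share⇒⊆ : {A B : Fin n → Bool} → Copy A → Copy B → ∀ z → A z ≡ true → B z ≡ true →
                ∀ x → A x ≡ true → B x ≡ true
      share⇒⊆ {A} {B} (cutA , |A|) (cutB , |B|) z Az Bz x Ax with κ <? count (λ x → A x ∧ B x)
      ... | yes κ<|∩| = proj₂ (∧-true {A x} (⊆-count-≥ ∩⊆A |A|≤|∩| x Ax))
        where
        ∩ ∪ : Fin n → Bool
        ∩ x = A x ∧ B x
        ∪ x = A x ∨ B x
        ∩⊆A : ∀ x → ∩ x ≡ true → A x ≡ true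
        ∩⊆A x = proj₁ ∘ ∧-true {A x}
        |∩|+|∪| : count ∩ + count ∪ ≡ s + s
        |∩|+|∪| = trans (count-∧-∨ A B) (cong₂ _+_ |A| |B|)
        ∪-balanced : Balanced ∪
        ∪-balanced =
          <-≤-trans (proj₁ S-balanced)
            (subst (_≤ count ∪) |A| (count-mono {p = A} λ x Ax → cong (_∨ B x) Ax)) ,
          -- `|A ∪ B| + κ < |A ∪ B| + |A ∩ B| = 2s ≤ n`.
          <-≤-trans (+-monoʳ-< (count ∪) κ<|∩|)
            (subst (_≤ n) (trans (sym |∩|+|∪|) (+-comm (count ∩) (count ∪))) 2|S|≤n)
        cut∩≤ : cut E ∩ ≤ cut E S
        cut∩≤ = +-cancelʳ-≤ (cut E S) _ _
          (≤-trans (+-monoʳ-≤ (cut E ∩) (cut-min ∪ ∪-balanced))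
          (≤-trans (cut-submodular E A B) (≤-reflexive (cong₂ _+_ cutA cutB))))
        |A|≤|∩| : count A ≤ count ∩
        |A|≤|∩| = subst (_≤ count ∩) (sym |A|)
          (size-min ∩ (balanced-smaller κ<|∩| (subst (count ∩ ≤_) |A| (count-mono ∩⊆A))) cut∩≤)
      ... | no κ≮|∩| = ⊥-elim (<⇒≱ |A∖B|<s
              (size-min (λ x → A x ∧ not (B x)) (∖-balanced A B |A| (≮⇒≥ κ≮|∩|)) cut∖≤))
        where
        |∩|>0 : 0 < count (λ x → A x ∧ B x)
        |∩|>0 = count-∈ z (trans (cong (_∧ B z) Az) Bz)
        |A∖B|<s : count (λ x → A x ∧ not (B x)) < s
        |A∖B|<s = subst (count (λ x → A x ∧ not (B x)) <_) (trans (count-∧-not A B) |A|)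
                    (m<n+m _ |∩|>0)
        ∖-balanced : ∀ C D → count C ≡ s → count (λ x → C x ∧ D x) ≤ κ →
                     Balanced (λ x → C x ∧ not (D x))
        ∖-balanced C D |C| |C∩D|≤κ = balanced-smaller
          -- From `|C| > 2κ` and `|C ∩ D| ≤ κ`, more than `κ` points remain.
          (+-cancelˡ-< κ κ _ (<-≤-trans 2κ<|S| (subst (_≤ κ + _) (trans (count-∧-not C D) |C|)
                                                 (+-monoˡ-≤ _ |C∩D|≤κ))))
          (subst (_ ≤_) (trans (count-∧-not C D) |C|) (m≤n+m _ (count λ x → C x ∧ D x)))
        cut∖≤ : cut E (λ x → A x ∧ not (B x)) ≤ cut E S
        cut∖≤ = +-cancelʳ-≤ (cut E S) _ _
          (≤-trans (+-monoʳ-≤ _ (cut-min _ (∖-balanced B A |B|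
            (subst (_≤ κ) (count-cong λ x → ∧-comm (A x) (B x)) (≮⇒≥ κ≮|∩|)))))
          (≤-trans (cut-posimodular E-sym A B) (≤-reflexive (cong₂ _+_ cutA cutB))))

      -- R relates x to the points of the translate of S through x.
      impossible : 1 ≤ κ → ⊥
      impossible 1≤κ with count-∃ (≤-<-trans z≤n (proj₁ S-balanced))
      ... | s₀ , Ss₀ = [ ¬trivial , ¬universal ]′ (proj₂ prim R (R-refl , R-sym , R-trans) R-inv)
        where
        σ : Fin n → Perm n
        σ x = proj₁ (proj₁ prim x s₀)
        σ-aut : ∀ x → IsAut Γ (σ x)
        σ-aut x = proj₁ (proj₂ (proj₁ prim x s₀))
        R : BRel n
        R x = S ∘ to (σ x)
        S-copy : Copy S
        S-copy = refl , refl
        R-copy : ∀ x → Copy (R x)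
        R-copy x = copy-∘ (σ x) (σ-aut x) S-copy
        R-refl : ∀ x → R x x ≡ true
        R-refl x = trans (cong S (proj₂ (proj₂ (proj₁ prim x s₀)))) Ss₀
        R-sym : ∀ x y → R x y ≡ true → R y x ≡ true
        R-sym x y Rxy = share⇒⊆ (R-copy x) (R-copy y) y Rxy (R-refl y) x (R-refl x)
        R-trans : ∀ x y z → R x y ≡ true → R y z ≡ true → R x z ≡ true
        R-trans x y z Rxy Ryz = share⇒⊆ (R-copy y) (R-copy x) y (R-refl y) Rxy z Ryz
        R-inv : ∀ τ → IsAut Γ τ → Preserves τ R
        -- `R x` and the preimage of `R (to τ x)` under `τ` are copies of `S` through `x`, so the
        -- first lies in the second.
        R-inv τ τ-aut x y Rxy = share⇒⊆ (R-copy x) (copy-∘ τ τ-aut (R-copy (to τ x))) x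
                                  (R-refl x) (R-refl (to τ x)) y Rxy
        S⊆R : ∀ x → S x ≡ true → R s₀ x ≡ true
        S⊆R = share⇒⊆ S-copy (R-copy s₀) s₀ Ss₀ (R-refl s₀)
        R⊆S : ∀ x → R s₀ x ≡ true → S x ≡ true
        R⊆S = share⇒⊆ (R-copy s₀) S-copy s₀ (R-refl s₀) Ss₀
        -- `R s₀` is `S`, which has at least two points because `κ ≥ 1`, and misses some point
        -- because `|S| + κ < n`.
        ¬trivial : ¬ (∀ x y → R x y ≡ true → x ≡ y)
        ¬trivial R-trivial = <⇒≱ (≤-<-trans 1≤κ (proj₁ S-balanced))
          (count-≤1 λ x y Sx Sy → trans (sym (R-trivial s₀ x (S⊆R x Sx))) (R-trivial s₀ y (S⊆R y Sy)))
        ¬universal : ¬ (∀ x y → R x y ≡ true)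
        ¬universal R-universal = <⇒≱ (proj₂ S-balanced)
          (≤-trans (≤-reflexive (sym (count-full λ x → R⊆S x (R-universal s₀ x)))) (m≤m+n s κ))

    module _ {m : ℕ} (E-irr : ∀ x → E x x ≡ false) (E-reg : ∀ x → count (E x) ≡ m)
             (1≤κ : 1 ≤ κ) (κ²+κ<m : κ * κ + κ < m) where

      -- Infinite descent: the induction hypothesis refutes every set of smaller measure that is
      -- balanced with cut at most `κ * m`, and this yields the minimality that makes `S` an atom.
      no-small-balanced-cut : ∀ S → Balanced S → ¬ cut E S ≤ κ * m
      no-small-balanced-cut S = go S (<-wellFounded (μ S))
        where
        -- Orders the pairs (cut E S, count S) lexicographically, as count S ≤ n.
        μ : (Fin n → Bool) → ℕ
        μ S = cut E S * suc n + count S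
        go : ∀ S → Acc _<_ (μ S) → Balanced S → ¬ cut E S ≤ κ * m
        go S (acc rec) S-balanced cutS≤ = Atom.impossible S S-balanced
          (large-if-small-cut
            (≤-trans (cut-lower-bound E-irr E-reg S) (+-monoˡ-≤ _ cutS≤)) (proj₁ S-balanced) κ²+κ<m)
          cut-min
          (λ T T-balanced cutT≤ → ≮⇒≥ λ |T|<|S| → go T
            (rec (+-mono-≤-< (*-monoˡ-≤ (suc n) cutT≤) |T|<|S|)) T-balanced (≤-trans cutT≤ cutS≤))
          1≤κ
          where
          open ≤-Reasoning
          cut-min : ∀ T → Balanced T → cut E S ≤ cut E T
          cut-min T T-balanced = ≮⇒≥ λ cutT< → go T (rec (begin-strict
            cut E T * suc n + count T  <⟨ +-monoʳ-< (cut E T * suc n) (s≤s (count-≤ T)) ⟩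
            cut E T * suc n + suc n    ≡⟨ +-comm (cut E T * suc n) (suc n) ⟩
            suc (cut E T) * suc n      ≤⟨ *-monoˡ-≤ (suc n) cutT< ⟩
            cut E S * suc n            ≤⟨ m≤m+n _ (count S) ⟩
            μ S                        ∎)) T-balanced (≤-trans (<⇒≤ cutT<) cutS≤)

-- The graphs Γᵢ

GammaI⇒≡ : (Γ : Digraph n) (d i : ℕ) {α β : Fin n} → GammaI Γ d i α β ≡ true → common Γ α β + i ≡ d
GammaI⇒≡ Γ d i {α} {β} eq with common Γ α β + i ≟ d
... | yes c+i≡d = c+i≡d

≡⇒GammaI : (Γ : Digraph n) (d i : ℕ) {α β : Fin n} → common Γ α β + i ≡ d → GammaI Γ d i α β ≡ true
≡⇒GammaI Γ d i {α} {β} c+i≡d with common Γ α β + i ≟ d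
... | yes _     = refl
... | no c+i≢d  = contradiction c+i≡d c+i≢d

module _ {Γ : Digraph n} where

  common-sym : ∀ α β → common Γ α β ≡ common Γ β α
  common-sym α β = count-cong λ γ → ∧-comm (Γ α γ) (Γ β γ)

  common-aut : ∀ σ → IsAut Γ σ → ∀ α β → common Γ (to σ α) (to σ β) ≡ common Γ α β
  common-aut σ σ-aut α β = trans (sym (count-perm σ λ γ → Γ (to σ α) γ ∧ Γ (to σ β) γ))
                                 (count-cong λ γ → cong₂ _∧_ (σ-aut α γ) (σ-aut β γ))

-- Counting in a vertex-primitive regular digraph

module _ {Γ : Digraph n} {d : ℕ} (prim : VertexPrimitive Γ) (Γ-reg : ∀ v → valency Γ v ≡ d) where

  private
    out-in-count : sum (λ x → count λ v → Γ v x) ≡ n * d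
    out-in-count = trans (sum-cong-≗ λ x → count≡sum λ v → Γ v x)
      (trans (∑-comm λ x v → ⟦ Γ v x ⟧)
      (trans (sum-cong-≗ λ v → trans (sym (count≡sum (Γ v))) (Γ-reg v)) (sum-const n)))

  -- Constant by transitivity, and counting the arcs by heads and by tails gives the average `d`.
  in-valency : ∀ x → count (λ v → Γ v x) ≡ d
  in-valency = constant-from-sum (invariant⇒constant prim in-inv) out-in-count
    where
    in-inv : ∀ σ → IsAut Γ σ → ∀ x → count (λ v → Γ v (to σ x)) ≡ count (λ v → Γ v x)
    in-inv σ σ-aut x = trans (sym (count-perm σ λ v → Γ v (to σ x))) (count-cong λ v → σ-aut v x)

  common-self : ∀ α → common Γ α α ≡ d
  common-self α = trans (count-cong λ γ → ∧-idem (Γ α γ)) (Γ-reg α)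

  common≤d : ∀ α β → common Γ α β ≤ d
  common≤d α β = subst (common Γ α β ≤_) (Γ-reg α) (count-mono λ γ → proj₁ ∘ ∧-true {Γ α γ})

  common≡d⇒⊆ : ∀ {α β} → common Γ α β ≡ d → ∀ γ → Γ α γ ≡ true → Γ β γ ≡ true
  common≡d⇒⊆ {α} {β} c≡d γ Γαγ =
    proj₂ (∧-true {Γ α γ} (⊆-count-≥ (λ γ → proj₁ ∘ ∧-true {Γ α γ})
      (≤-reflexive (trans (Γ-reg α) (sym c≡d))) γ Γαγ))

  ⊆⇒common≡d : ∀ {α β} → (∀ γ → Γ α γ ≡ true → Γ β γ ≡ true) → common Γ α β ≡ d
  ⊆⇒common≡d {α} {β} α⊆β = trans (count-cong λ γ → absorb (Γ α γ) (α⊆β γ)) (Γ-reg α)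
    where
    absorb : ∀ a {b} → (a ≡ true → b ≡ true) → a ∧ b ≡ a
    absorb true  a⇒b = a⇒b refl
    absorb false a⇒b = refl

  -- Each of the `d` points `γ` of `Γ(α)` lies in `Γ(β)` for exactly `d` vertices `β`, by
  -- `in-valency`.
  sum-common : ∀ α → sum (common Γ α) ≡ d * d
  sum-common α = begin
    sum (common Γ α)
      ≡⟨ sum-cong-≗ (λ β → count≡sum λ γ → Γ α γ ∧ Γ β γ) ⟩
    ∑∑ (λ β γ → ⟦ Γ α γ ∧ Γ β γ ⟧)
      ≡⟨ ∑-comm (λ β γ → ⟦ Γ α γ ∧ Γ β γ ⟧) ⟩
    ∑∑ (λ γ β → ⟦ Γ α γ ∧ Γ β γ ⟧)
      ≡⟨ sum-cong-≗ column ⟩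
    sum (λ γ → ⟦ Γ α γ ⟧ * d)
      ≡⟨ *-distribʳ-sum d (⟦_⟧ ∘ Γ α) ⟨
    sum (⟦_⟧ ∘ Γ α) * d
      ≡⟨ cong (_* d) (trans (sym (count≡sum (Γ α))) (Γ-reg α)) ⟩
    d * d ∎
    where
    open ≡-Reasoning
    column : ∀ γ → sum (λ β → ⟦ Γ α γ ∧ Γ β γ ⟧) ≡ ⟦ Γ α γ ⟧ * d
    column γ = begin
      sum (λ β → ⟦ Γ α γ ∧ Γ β γ ⟧)      ≡⟨ sum-cong-≗ (λ β → ⟦∧⟧ (Γ α γ) (Γ β γ)) ⟩
      sum (λ β → ⟦ Γ α γ ⟧ * ⟦ Γ β γ ⟧)  ≡⟨ *-distribˡ-sum ⟦ Γ α γ ⟧ (λ β → ⟦ Γ β γ ⟧) ⟨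
      ⟦ Γ α γ ⟧ * sum (λ β → ⟦ Γ β γ ⟧)  ≡⟨ cong (⟦ Γ α γ ⟧ *_) (trans (sym (count≡sum λ β → Γ β γ)) (in-valency γ)) ⟩
      ⟦ Γ α γ ⟧ * d                      ∎

  -- The union of two neighbourhoods has at most `n` points; this is the bound
  -- `|Γ(α) ∖ Γ(β)| ≤ n - d`.
  common+n≥2d : ∀ α β → d + d ≤ common Γ α β + n
  common+n≥2d α β = subst (_≤ common Γ α β + n)
    (trans (count-∧-∨ (Γ α) (Γ β)) (cong₂ _+_ (Γ-reg α) (Γ-reg β)))
    (+-monoʳ-≤ (common Γ α β) (count-≤ λ γ → Γ α γ ∨ Γ β γ))

  -- The graph `Γ_κ`

  module _ {κ : ℕ} (1≤κ : 1 ≤ κ) where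

    private
      E : BRel n
      E = GammaI Γ d κ

    GammaI-sym : ∀ α β → E α β ≡ E β α
    GammaI-sym α β = cong (λ c → ⌊ c + κ ≟ d ⌋) (common-sym {Γ = Γ} α β)

    GammaI-inv : ∀ σ → IsAut Γ σ → ∀ α β → E (to σ α) (to σ β) ≡ E α β
    GammaI-inv σ σ-aut α β = cong (λ c → ⌊ c + κ ≟ d ⌋) (common-aut {Γ = Γ} σ σ-aut α β)

    GammaI-irr : ∀ α → E α α ≡ false
    GammaI-irr α = ¬-not λ Eαα →
      <⇒≢ (m<m+n d 1≤κ) (sym (trans (cong (_+ κ) (sym (common-self α))) (GammaI⇒≡ Γ d κ Eαα)))

    GammaI-valency-constant : ∀ α β → valency E α ≡ valency E β
    GammaI-valency-constant = invariant⇒constant prim λ σ σ-aut α →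
      trans (sym (count-perm σ (E (to σ α)))) (count-cong (GammaI-inv σ σ-aut α))

    -- `Γ₀` relates vertices with equal neighbourhoods, hence is an invariant equivalence relation;
    -- primitivity makes it equality or everything.
    common≡d⇒≡ : NonEmpty E → ∀ α β → common Γ α β ≡ d → α ≡ β
    common≡d⇒≡ (α₁ , β₁ , E₁) α β c≡d with proj₂ prim (GammaI Γ d 0) (R-refl , R-sym , R-trans) R-inv
      where
      R-refl : ∀ α → GammaI Γ d 0 α α ≡ true
      R-refl α = ≡⇒GammaI Γ d 0 (trans (+-identityʳ _) (common-self α))
      R-sym : ∀ α β → GammaI Γ d 0 α β ≡ true → GammaI Γ d 0 β α ≡ true
      R-sym α β = trans (cong (λ c → ⌊ c + 0 ≟ d ⌋) (common-sym {Γ = Γ} β α))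
      R⇒⊆ : ∀ {α β} → GammaI Γ d 0 α β ≡ true → ∀ γ → Γ α γ ≡ true → Γ β γ ≡ true
      R⇒⊆ R = common≡d⇒⊆ (trans (sym (+-identityʳ _)) (GammaI⇒≡ Γ d 0 R))
      R-trans : ∀ α β γ → GammaI Γ d 0 α β ≡ true → GammaI Γ d 0 β γ ≡ true → GammaI Γ d 0 α γ ≡ true
      R-trans α β γ Rαβ Rβγ =
        ≡⇒GammaI Γ d 0 (trans (+-identityʳ _) (⊆⇒common≡d λ x → R⇒⊆ Rβγ x ∘ R⇒⊆ Rαβ x))
      R-inv : ∀ σ → IsAut Γ σ → Preserves σ (GammaI Γ d 0)
      R-inv σ σ-aut α β = trans (cong (λ c → ⌊ c + 0 ≟ d ⌋) (common-aut {Γ = Γ} σ σ-aut α β))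
    ... | inj₁ R-trivial   = R-trivial α β (≡⇒GammaI Γ d 0 (trans (+-identityʳ _) c≡d))
    -- At an arc of `Γ_κ` universality would give `c + 0 = d = c + κ`, against `κ ≥ 1`.
    ... | inj₂ R-universal = contradiction
      (+-cancelˡ-≡ (common Γ α₁ β₁) 0 κ
        (trans (GammaI⇒≡ Γ d 0 (R-universal α₁ β₁)) (sym (GammaI⇒≡ Γ d κ E₁))))
      (<⇒≢ 1≤κ)

    -- Every arc (v , u) of Γ_κ lies in the cut of exactly |Γ(v) ∖ Γ(u)| = κ of the n in-neighbourhoods,
    -- and by transitivity all these cuts have the same size.
    in-neighbourhood-cut : ∀ {m} → (∀ α → valency E α ≡ m) → ∀ x → cut E (λ v → Γ v x) ≡ κ * m
    in-neighbourhood-cut {m} E-reg = constant-from-sum (invariant⇒constant prim cut-inv) (begin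
      sum (λ x → cut E (λ v → Γ v x))
        ≡⟨ ∑-comm (λ x v → sum λ u → ⟦ Γ v x ∧ not (Γ u x) ∧ E v u ⟧) ⟩
      sum (λ v → sum λ x → sum λ u → ⟦ Γ v x ∧ not (Γ u x) ∧ E v u ⟧)
        ≡⟨ sum-cong-≗ (λ v → ∑-comm (λ x u → ⟦ Γ v x ∧ not (Γ u x) ∧ E v u ⟧)) ⟩
      sum (λ v → sum λ u → sum λ x → ⟦ Γ v x ∧ not (Γ u x) ∧ E v u ⟧)
        ≡⟨ ∑∑-cong separated ⟩
      sum (λ v → sum λ u → κ * ⟦ E v u ⟧)
        ≡⟨ sum-cong-≗ (λ v → trans (sym (*-distribˡ-sum κ (⟦_⟧ ∘ E v)))
             (cong (κ *_) (trans (sym (count≡sum (E v))) (E-reg v)))) ⟩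
      sum {n} (λ v → κ * m)
        ≡⟨ sum-const n ⟩
      n * (κ * m) ∎)
      where
      open ≡-Reasoning
      cut-inv : ∀ σ → IsAut Γ σ → ∀ x → cut E (λ v → Γ v (to σ x)) ≡ cut E (λ v → Γ v x)
      cut-inv σ σ-aut x = trans (sym (cut-perm σ (GammaI-inv σ σ-aut) λ v → Γ v (to σ x)))
                                (cut-cong E λ v → σ-aut v x)
      separated : ∀ v u → sum (λ x → ⟦ Γ v x ∧ not (Γ u x) ∧ E v u ⟧) ≡ κ * ⟦ E v u ⟧
      separated v u with E v u in Evu
      ... | false = trans (sum-cong-≗ λ x → cong ⟦_⟧
                      (trans (cong (Γ v x ∧_) (∧-zeroʳ (not (Γ u x)))) (∧-zeroʳ (Γ v x))))
                    (trans (sum-const n) (trans (*-zeroʳ n) (sym (*-zeroʳ κ))))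
      ... | true  = begin
        sum (λ x → ⟦ Γ v x ∧ not (Γ u x) ∧ true ⟧)
          ≡⟨ sum-cong-≗ (λ x → cong (λ b → ⟦ Γ v x ∧ b ⟧) (∧-identityʳ (not (Γ u x)))) ⟩
        sum (λ x → ⟦ Γ v x ∧ not (Γ u x) ⟧)
          ≡⟨ count≡sum (λ x → Γ v x ∧ not (Γ u x)) ⟨
        count (λ x → Γ v x ∧ not (Γ u x))
          ≡⟨ +-cancelˡ-≡ (common Γ v u) _ _ (trans (count-∧-not (Γ v) (Γ u))
               (trans (Γ-reg v) (sym (GammaI⇒≡ Γ d κ Evu)))) ⟩
        κ
          ≡⟨ *-identityʳ κ ⟨
        κ * 1 ∎

    -- The hypothesis on `common` bounds `|Γ(α) ∖ Γ(β)|` by `κ`, and by leastness of `κ` its value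
    -- is `0` or `κ`. In the sum `Σ_β |Γ(α) ∩ Γ(β)| = d²` the vertex `α` then contributes `d` and
    -- each of the `n - 1` others `d - κ`.
    complete-case : NonEmpty E → (∀ i → 1 ≤ i → i < κ → ¬ NonEmpty (GammaI Γ d i)) →
      (∀ α β → d ≤ common Γ α β + κ) →
      (∀ α β → (GammaI Γ d 0 α β ≡ true) ⊎ (E α β ≡ true)) × ((n ∸ 1) * (d ∸ κ) ≡ d * (d ∸ 1))
    complete-case E≠∅ κ-least d≤c+κ = complete , design n refl
      where
      complete : ∀ α β → (GammaI Γ d 0 α β ≡ true) ⊎ (E α β ≡ true)
      complete α β with d ∸ common Γ α β in i≡ | m+[n∸m]≡n (common≤d α β)
      ... | zero  | c+i≡d = inj₁ (≡⇒GammaI Γ d 0 c+i≡d)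
      ... | suc i | c+i≡d with m≤n⇒m<n∨m≡n (subst (_≤ κ) i≡ (m≤n+o⇒m∸n≤o d (common Γ α β) (d≤c+κ α β)))
      ...   | inj₁ i<κ  = contradiction (α , β , ≡⇒GammaI Γ d (suc i) c+i≡d) (κ-least (suc i) (s≤s z≤n) i<κ)
      ...   | inj₂ refl = inj₂ (≡⇒GammaI Γ d (suc i) c+i≡d)

      common-distinct : ∀ {α β} → α ≢ β → common Γ α β ≡ d ∸ κ
      common-distinct {α} {β} α≢β with complete α β
      ... | inj₁ Γ₀αβ = contradiction
              (common≡d⇒≡ E≠∅ α β (trans (sym (+-identityʳ _)) (GammaI⇒≡ Γ d 0 Γ₀αβ))) α≢β
      ... | inj₂ Eαβ  = trans (sym (m+n∸n≡m _ κ)) (cong (_∸ κ) (GammaI⇒≡ Γ d κ Eαβ))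

      -- The case split is on a copy `n′` of the parameter `n`; the vertex in `E≠∅` excludes
      -- `n = 0`.
      design : ∀ n′ → n ≡ n′ → (n′ ∸ 1) * (d ∸ κ) ≡ d * (d ∸ 1)
      design zero     refl = case proj₁ E≠∅ of λ ()
      design (suc n′) refl = begin
        n′ * (d ∸ κ)            ≡⟨ m+n∸m≡n d _ ⟨
        d + n′ * (d ∸ κ) ∸ d    ≡⟨ cong (_∸ d) total ⟩
        d * d ∸ d               ≡⟨ cong (d * d ∸_) (*-identityʳ d) ⟨
        d * d ∸ d * 1           ≡⟨ *-distribˡ-∸ d d 1 ⟨
        d * (d ∸ 1)             ∎
        where
        open ≡-Reasoning
        α = proj₁ E≠∅
        total : d + n′ * (d ∸ κ) ≡ d * d
        total = begin
          d + n′ * (d ∸ κ)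
            ≡⟨ cong₂ _+_ (common-self α) (sum-const n′) ⟨
          common Γ α α + sum {n′} (λ _ → d ∸ κ)
            ≡⟨ cong (common Γ α α +_) (sum-cong-≗ λ j → common-distinct (punchInᵢ≢i α j ∘ sym)) ⟨
          common Γ α α + sum (common Γ α ∘ punchIn α)
            ≡⟨ sum-remove {i = α} (common Γ α) ⟨
          sum (common Γ α)
            ≡⟨ sum-common α ⟩
          d * d ∎

theorem1p1 : (n : ℕ) (Γ : Digraph n) (d κ : ℕ) →
    VertexPrimitive Γ → NonEmpty Γ → ¬ IsFull Γ →
    (∀ v → valency Γ v ≡ d) →
    1 ≤ κ → NonEmpty (GammaI Γ d κ) →
    (∀ i → 1 ≤ i → i < κ → ¬ NonEmpty (GammaI Γ d i)) →
    ((∀ α β → (GammaI Γ d 0 α β ≡ true) ⊎ (GammaI Γ d κ α β ≡ true))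
    × ((n ∸ 1) * (d ∸ κ) ≡ d * (d ∸ 1)))
    ⊎ (∃[ i ] (κ ≤ i × i < d
    × (∀ v → 1 ≤ valency (GammaI Γ d i) v × valency (GammaI Γ d i) v ≤ κ ^ 2 + κ)))
theorem1p1 n Γ d κ prim _ _ Γ-reg 1≤κ E≠∅@(α₀ , β₀ , E₀) κ-least with κ <? d
-- Here `|Γ(α) ∖ Γ(β)| ≤ d ≤ κ`.
... | no κ≮d = inj₁ (complete-case prim Γ-reg 1≤κ E≠∅ κ-least λ α β → ≤-trans (≮⇒≥ κ≮d) (m≤n+m κ _))
... | yes κ<d with valency (GammaI Γ d κ) α₀ ≤? κ * κ + κ
...   | yes m≤κ²+κ = inj₂ (κ , ≤-refl , κ<d , λ v →
        subst (1 ≤_) (E-reg v) (count-∈ β₀ E₀) ,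
        -- `κ ^ 2` unfolds to `κ * (κ * 1)`.
        subst₂ _≤_ (E-reg v) (cong (λ k → κ * k + κ) (sym (*-identityʳ κ))) m≤κ²+κ)
  where
  E-reg = GammaI-valency-constant prim Γ-reg 1≤κ α₀
...   | no m≰κ²+κ with d + κ <? n
-- With `n ≤ d + κ` and `c = common Γ α β`, inclusion-exclusion gives `2d ≤ c + n ≤ c + d + κ`.
...     | no d+κ≮n = inj₁ (complete-case prim Γ-reg 1≤κ E≠∅ κ-least λ α β → +-cancelʳ-≤ d _ _
          (≤-trans (common+n≥2d prim Γ-reg α β)
          (≤-trans (+-monoʳ-≤ (common Γ α β) (≮⇒≥ d+κ≮n))
                   (≤-reflexive (rearrange (common Γ α β) d κ)))))
  where
  rearrange : ∀ c d κ → c + (d + κ) ≡ c + κ + d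
  rearrange = solve-∀
-- The in-neighbourhood of `α₀` has `d` points, so it is balanced, and its cut is `κ * m`, which is
-- too small.
...     | yes d+κ<n = ⊥-elim (no-small-balanced-cut prim
          (GammaI-sym prim Γ-reg 1≤κ) (GammaI-inv prim Γ-reg 1≤κ) (GammaI-irr prim Γ-reg 1≤κ)
          E-reg 1≤κ (≰⇒> m≰κ²+κ) (λ v → Γ v α₀)
          (subst (κ <_) |S|≡d κ<d , subst (λ s → s + κ < n) |S|≡d d+κ<n)
          (≤-reflexive (in-neighbourhood-cut prim Γ-reg 1≤κ E-reg α₀)))
  where
  E-reg : ∀ α → valency (GammaI Γ d κ) α ≡ valency (GammaI Γ d κ) α₀
  E-reg α = GammaI-valency-constant prim Γ-reg 1≤κ α α₀
  |S|≡d : d ≡ count (λ v → Γ v α₀)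
  |S|≡d = sym (in-valency prim Γ-reg α₀)
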